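{- Let $W\ge1$ be an integer and let $\epsilon>0$ be such that $k=\frac{1}{2\epsilon}$ and $\frac{W}{k}$ are integers. Then Algorithm 1 (described in the context, run with these parameters) requires $$\frac{1}{2\epsilon}+2\log W+O(1)$$ bits of memory.
   Context: All logarithms are base 2, and $O(1)$ denotes a quantity bounded by an absolute constant. The memory of the algorithm is the number of bits used to store its variables. Algorithm 1. Variables: integers $y,m,i,B$ and a bit array $b=(b_0,\dots,b_{k-1})$, all initialized to $0$. Add(bit $x$): If $m=\frac Wk-1$, then do in order: (1) $B\leftarrow B-b_i$; (2) if $y+x\ge\frac Wk$, set $b_i\leftarrow1$ and $y\leftarrow y-\frac Wk+x$; otherwise set $b_i\leftarrow0$ and $y\leftarrow y+x$; (3) $B\leftarrow B+b_i$; (4) $m\leftarrow0$; (5) $i\leftarrow i+1 \bmod k$. Otherwise (if $m\neq\frac Wk-1$): $y\leftarrow y+x$ and $m\leftarrow m+1$. Query: return $\frac Wk\cdot B+y-\frac{W}{2k}-m\cdot b_i$. Each arriving bit of the input stream is processed by one call of Add. The variables $y,m,i,B$ are stored as binary integers with enough bits for their ranges, and $b$ is stored as $k$ bits. -}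

module Defs where

open import Data.Bool.Base using (Bool; true; false)
open import Data.Fin.Base as Fin using (Fin; toℕ)
open import Data.Integer.Base as ℤ using (ℤ; +_; 0ℤ; 1ℤ)
import Data.Integer.Properties as ℤ
open import Data.List.Base using (List; []; _∷_; foldl)
open import Data.List.Membership.Propositional using (_∈_)
open import Data.List.Scans.Base using (scanl)
open import Data.Nat.Base as ℕ using (ℕ; suc; NonZero)
open import Data.Nat.DivMod using (_mod_)
open import Data.Product.Base using (_×_)
open import Data.Rational.Base as ℚ using (ℚ; Positive; 1ℚ; ½)
import Data.Rational.Properties as ℚ
open import Data.Vec.Base using (Vec; lookup; replicate; _[_]≔_)
open import Relation.Binary.PropositionalEquality using (_≡_)
open import Relation.Nullary.Decidable using (yes; no)

1/2⟨_⟩ : (ε : ℚ) → .{{Positive ε}} → ℚ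
1/2⟨ ε ⟩ = (1ℚ ℚ.÷ (2ℚ ℚ.* ε)) {{ℚ.pos⇒nonZero (2ℚ ℚ.* ε) {{ℚ.pos*pos⇒pos 2ℚ ε}}}}
  where
  2ℚ : ℚ
  2ℚ = + 2 ℚ./ 1

bit : Bool → ℤ
bit false = 0ℤ
bit true  = 1ℤ

-- Natural-number division agrees with W/k only when k divides W.
module Algorithm (W k : ℕ) .{{_ : NonZero k}} where

  W/k : ℤ
  W/k = + (W ℕ./ k)

  record State : Set where
    constructor state
    field
      y m : ℤ
      i   : Fin k
      B   : ℤ
      b   : Vec Bool k

    bᵢ : ℤ
    bᵢ = bit (lookup b i)

  open State

  initial : State
  initial = state 0ℤ 0ℤ (0 mod k) 0ℤ (replicate k false)

  carry : Bool → State → State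
  carry x s with W/k ℤ.≤? y s ℤ.+ bit x
  ... | yes _ = record s { b = b s [ i s ]≔ true  ; y = y s ℤ.- W/k ℤ.+ bit x }
  ... | no  _ = record s { b = b s [ i s ]≔ false ; y = y s ℤ.+ bit x }

  -- The assignments executed, in order, by Add x when called in the given state.
  steps : Bool → State → List (State → State)
  steps x s with m s ℤ.≟ W/k ℤ.- 1ℤ
  ... | yes _ = (λ t → record t { B = B t ℤ.- bᵢ t })
              ∷ carry x
              ∷ (λ t → record t { B = B t ℤ.+ bᵢ t })
              ∷ (λ t → record t { m = 0ℤ })
              ∷ (λ t → record t { i = suc (toℕ (i t)) mod k })
              ∷ []
  ... | no  _ = (λ t → record t { y = y t ℤ.+ bit x })
              ∷ (λ t → record t { m = m t ℤ.+ 1ℤ })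
              ∷ []

  execute : State → List (State → State) → State
  execute = foldl (λ t f → f t)

  add : State → Bool → State
  add s x = execute s (steps x s)

  -- All states passed through during Add x, the first and last included.
  trace : Bool → State → List State
  trace x s = scanl (λ t f → f t) s (steps x s)

  run : List Bool → State
  run = foldl add initial

  query : State → ℚ
  query s = (W/k ℤ.* B s ℤ.+ y s ℤ.- m s ℤ.* bᵢ s) ℚ./ 1 ℚ.- ½ ℚ.* (W/k ℚ./ 1)

  -- The memory has to hold the variables also between the assignments of one call of Add.
  data Reachable : State → Set where
    during : ∀ xs x {s} → s ∈ trace x (run xs) → Reachable s

  FitsIn : ℕ → ℤ → Set
  FitsIn w v = 0ℤ ℤ.≤ v × v ℤ.< + (2 ℕ.^ w)

  Enough : (State → ℤ) → ℕ → Set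
  Enough var w = ∀ {s} → Reachable s → FitsIn w (var s)

  record Width (var : State → ℤ) (w : ℕ) : Set where
    field
      enough : Enough var w
      least  : ∀ {w′} → Enough var w′ → w ℕ.≤ w′

  record RequiresBits (M : ℕ) : Set where
    field
      {wy wm wi wB} : ℕ
      width-y : Width y wy
      width-m : Width m wm
      width-i : Width (λ s → + toℕ (i s)) wi
      width-B : Width B wB
      total   : M ≡ k ℕ.+ (wy ℕ.+ wm ℕ.+ wi ℕ.+ wB)

-- | M - (k + 2 log W) | ≤ C for the real base-2 logarithm and W ≥ 1: both inequalities
-- are exponentiated, since 2 ^ (2 log W) = W ^ 2.
∣_-[_+2log_]∣≤_ : (M k W C : ℕ) → Set
∣ M -[ k +2log W ]∣≤ C =
    2 ℕ.^ M ℕ.≤ 2 ℕ.^ (k ℕ.+ C) ℕ.* W ℕ.^ 2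
  × 2 ℕ.^ k ℕ.* W ℕ.^ 2 ℕ.≤ 2 ℕ.^ (M ℕ.+ C)

{-# OPTIONS --safe #-}
module Submission where

-- Write n = W/k = p + 1 for the length of a block.  The least and the greatest value that each
-- variable takes, over all inputs and all moments of a call of Add, can be computed exactly:
--
--   0 ≤ y ≤ 2p,   0 ≤ m ≤ p,   0 ≤ i ≤ k - 1,   0 ≤ B ≤ k.
--
-- The upper bounds follow from an invariant that holds between calls: m ≤ p, y ≤ p + m, and B is
-- the number of ones in b (`settled-call`, `reachable-inRange`).  Each upper bound is attained:
-- m after p ones (`run-ones`), y after p ones, a zero, and p more ones (the zero closes the block
-- without a carry and leaves y = p; `run-peak`), i and B on a stream of ones, where each of
-- the first k blocks sets one further bit of b (`run-blocks`).
--
-- A variable with greatest value h takes the least w with h < 2 ^ w, for which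
-- h + 1 ≤ 2 ^ w ≤ 2 (h + 1) (`binaryWidth`).  So if M is the total width, 2 ^ (M - k) is at least
-- (2p + 1) n k (k + 1) ≥ (n k)² = W² and at most 2⁴ (2p + 1) n k (k + 1) ≤ 2⁶ W²,
-- which is the claim with the constant 6 (`total-width`).

open import Defs
open import Data.Bool.Base using (Bool; true; false)
open import Data.Fin.Base using (Fin; zero; suc; toℕ)
import Data.Fin.Properties as Fin
open import Data.Integer.Base as ℤ using (ℤ; +_; 0ℤ; 1ℤ; _⊖_)
import Data.Integer.Properties as ℤ
open import Data.List.Base using (List; []; _∷_; _++_; [_]; foldl)
import Data.List.Base as List
open import Data.List.Properties using (foldl-++)
open import Data.List.Relation.Unary.All as All using (All; []; _∷_)
open import Data.List.Relation.Unary.Any using (here)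
open import Data.List.Scans.Base using (scanl)
open import Data.Nat.Base as ℕ using (ℕ; zero; suc; pred; NonZero; _≥_; _+_; _*_; _∸_; _^_; _≤_; _<_; z≤n; s≤s)
open import Data.Nat.Divisibility using (_∣_; divides)
open import Data.Nat.DivMod using (_%_; _mod_; m%n<n; m<n⇒m%n≡m; %-distribˡ-+; m%n%n≡m%n; m*n/n≡m)
open import Data.Nat.Properties
open import Data.Nat.Tactic.RingSolver using (solve-∀)
open import Data.Product.Base using (∃-syntax; _×_; _,_; proj₂)
open import Data.Rational.Base using (ℚ; Positive; _/_)
open import Data.Vec.Base using (Vec; []; _∷_; lookup; replicate; _[_]≔_)
open import Data.Vec.Properties using (lookup∘update; lookup∘update′; []≔-idempotent)
open import Function.Base using (_∘_)
open import Relation.Binary.PropositionalEquality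
  using (_≡_; refl; sym; trans; cong; cong₂; subst; subst₂; module ≡-Reasoning)
open import Relation.Nullary using (yes; no; contradiction)

-- Counting ones

-- The value of a bit as a natural number.
⟦_⟧ : Bool → ℕ
⟦ false ⟧ = 0
⟦ true  ⟧ = 1

⟦⟧≤1 : ∀ x → ⟦ x ⟧ ≤ 1
⟦⟧≤1 false = z≤n
⟦⟧≤1 true  = s≤s z≤n

bit-⟦⟧ : ∀ x → bit x ≡ + ⟦ x ⟧
bit-⟦⟧ false = refl
bit-⟦⟧ true  = refl

-- The number of ones in a bit array.
ones : ∀ {n} → Vec Bool n → ℕ
ones []      = 0
ones (x ∷ b) = ⟦ x ⟧ + ones b

ones≤n : ∀ {n} (b : Vec Bool n) → ones b ≤ n
ones≤n []      = z≤n
ones≤n (x ∷ b) = +-mono-≤ (⟦⟧≤1 x) (ones≤n b)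

ones-replicate-false : ∀ n → ones (replicate n false) ≡ 0
ones-replicate-false zero    = refl
ones-replicate-false (suc n) = ones-replicate-false n

ones-allTrue : ∀ {n} (b : Vec Bool n) → (∀ l → lookup b l ≡ true) → ones b ≡ n
ones-allTrue []      _   = refl
ones-allTrue (x ∷ b) all = cong₂ (λ x n → ⟦ x ⟧ + n) (all zero) (ones-allTrue b (all ∘ suc))

ones-clear : ∀ {n} (b : Vec Bool n) i → ones b ≡ ones (b [ i ]≔ false) + ⟦ lookup b i ⟧
ones-clear (x ∷ b) zero    = +-comm ⟦ x ⟧ (ones b)
ones-clear (x ∷ b) (suc i) = trans (cong (λ n → ⟦ x ⟧ + n) (ones-clear b i)) (sym (+-assoc ⟦ x ⟧ _ _))

ones-set : ∀ {n} (b : Vec Bool n) i c → ones (b [ i ]≔ c) ≡ ones (b [ i ]≔ false) + ⟦ c ⟧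
ones-set b i c = trans (ones-clear (b [ i ]≔ c) i)
  (cong₂ (λ b′ x → ones b′ + ⟦ x ⟧) ([]≔-idempotent b i) (lookup∘update i b c))

-- Natural numbers among the integers

+m+bit : ∀ m x → + m ℤ.+ bit x ≡ + (m + ⟦ x ⟧)
+m+bit m x = cong (λ z → + m ℤ.+ z) (bit-⟦⟧ x)

-- The difference u - v may be negative here, and only becomes a natural number when w is added.
u-v+w : ∀ u v w {d} → v + d ≡ u + w → + u ℤ.- + v ℤ.+ + w ≡ + d
u-v+w u v w {d} eq = begin
  + u ℤ.- + v ℤ.+ + w        ≡⟨ ℤ.+-assoc (+ u) (ℤ.- + v) (+ w) ⟩
  + u ℤ.+ (ℤ.- + v ℤ.+ + w)  ≡⟨ cong (λ z → + u ℤ.+ z) (ℤ.+-comm (ℤ.- + v) (+ w)) ⟩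
  + u ℤ.+ (+ w ℤ.- + v)      ≡⟨ ℤ.+-assoc (+ u) (+ w) (ℤ.- + v) ⟨
  + (u + w) ℤ.- + v          ≡⟨ cong (λ z → + z ℤ.- + v) eq ⟨
  + (v + d) ℤ.- + v          ≡⟨ ℤ.m-n≡m⊖n (v + d) v ⟩
  (v + d) ⊖ v                ≡⟨ ℤ.⊖-≥ (m≤m+n v d) ⟩
  + (v + d ∸ v)              ≡⟨ cong +_ (m+n∸m≡n v d) ⟩
  + d                        ∎
  where open ≡-Reasoning

ones-subtract : ∀ {n} (b : Vec Bool n) i →
                + ones b ℤ.- bit (lookup b i) ≡ + ones (b [ i ]≔ false)
ones-subtract b i = begin
  + ones b ℤ.- bit x          ≡⟨ cong (λ z → + ones b ℤ.- z) (bit-⟦⟧ x) ⟩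
  + ones b ℤ.- + ⟦ x ⟧        ≡⟨ ℤ.+-identityʳ _ ⟨
  + ones b ℤ.- + ⟦ x ⟧ ℤ.+ 0ℤ ≡⟨ u-v+w (ones b) ⟦ x ⟧ 0
                                 (trans (+-comm ⟦ x ⟧ _) (trans (sym (ones-clear b i)) (sym (+-identityʳ _)))) ⟩
  + ones (b [ i ]≔ false)     ∎
  where
  open ≡-Reasoning
  x = lookup b i

ones-add : ∀ {n} (b : Vec Bool n) i c →
           + ones (b [ i ]≔ false) ℤ.+ bit (lookup (b [ i ]≔ c) i) ≡ + ones (b [ i ]≔ c)
ones-add b i c = begin
  + r ℤ.+ bit (lookup (b [ i ]≔ c) i) ≡⟨ cong (λ x → + r ℤ.+ bit x) (lookup∘update i b c) ⟩
  + r ℤ.+ bit c                       ≡⟨ +m+bit r c ⟩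
  + (r + ⟦ c ⟧)                       ≡⟨ cong +_ (ones-set b i c) ⟨
  + ones (b [ i ]≔ c)                 ∎
  where
  open ≡-Reasoning
  r = ones (b [ i ]≔ false)

suc-mod : ∀ j k .{{_ : NonZero k}} → suc (toℕ (j mod k)) mod k ≡ suc j mod k
suc-mod j k = Fin.toℕ-injective (begin
  toℕ (suc (toℕ (j mod k)) mod k) ≡⟨ Fin.toℕ-fromℕ< (m%n<n (suc (toℕ (j mod k))) k) ⟩
  suc (toℕ (j mod k)) % k         ≡⟨ cong (λ r → suc r % k) (Fin.toℕ-fromℕ< (m%n<n j k)) ⟩
  suc (j % k) % k                 ≡⟨ %-distribˡ-+ 1 (j % k) k ⟩
  (1 % k + j % k % k) % k         ≡⟨ cong (λ r → (1 % k + r) % k) (m%n%n≡m%n j k) ⟩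
  (1 % k + j % k) % k             ≡⟨ %-distribˡ-+ 1 j k ⟨
  suc j % k                       ≡⟨ Fin.toℕ-fromℕ< (m%n<n (suc j) k) ⟨
  toℕ (suc j mod k)               ∎)
  where open ≡-Reasoning

toℕ-mod : ∀ {k} .{{_ : NonZero k}} (l : Fin k) → toℕ l mod k ≡ l
toℕ-mod {k} l = Fin.toℕ-injective
  (trans (Fin.toℕ-fromℕ< (m%n<n (toℕ l) k)) (m<n⇒m%n≡m (Fin.toℕ<n l)))

-- Widths of binary numbers

-- w is the number of binary digits of h, where 0 has none: the lower bound h < 2 ^ w makes room
-- for h, and the upper bound, which is equivalent to 2 ^ w ≤ 2 h for h > 0, makes w minimal.
record BinaryWidth (h w : ℕ) : Set where
  field
    fits  : h < 2 ^ w
    tight : 2 ^ w ≤ suc (2 * h)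

binaryWidth : ∀ h → ∃[ w ] BinaryWidth h w
binaryWidth zero = 0 , record { fits = s≤s z≤n ; tight = s≤s z≤n }
binaryWidth (suc h) with binaryWidth h
... | w , record { fits = h<2^w ; tight = 2^w≤ } with suc h <? 2 ^ w
...   | yes fits = w , record
  { fits  = fits
  ; tight = ≤-trans 2^w≤ (s≤s (*-monoʳ-≤ 2 (n≤1+n h)))
  }
...   | no ≮2^w = suc w , record
  { fits  = ≤-<-trans h<2^w (^-monoʳ-< 2 ≤-refl (n<1+n w))
  ; tight = m≤n⇒m≤1+n (*-monoʳ-≤ 2 (≮⇒≥ ≮2^w))
  }

module _ {h w : ℕ} (width : BinaryWidth h w) where
  open BinaryWidth width

  binaryWidth-least : ∀ {w′} → h < 2 ^ w′ → w ≤ w′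
  binaryWidth-least {w′} h<2^w′ = ≮⇒≥ λ w′<w → <⇒≱ (s≤s ≤-refl) (begin
    suc (suc (2 * h)) ≡⟨ *-suc 2 h ⟨
    2 * suc h         ≤⟨ *-monoʳ-≤ 2 h<2^w′ ⟩
    2 ^ suc w′        ≤⟨ ^-monoʳ-≤ 2 w′<w ⟩
    2 ^ w             ≤⟨ tight ⟩
    suc (2 * h)       ∎)
    where open ≤-Reasoning

  binaryWidth-upper : ∀ {n} → suc h ≤ n → 2 ^ w ≤ 2 * n
  binaryWidth-upper {n} h<n = begin
    2 ^ w             ≤⟨ tight ⟩
    suc (2 * h)       ≤⟨ n≤1+n _ ⟩
    suc (suc (2 * h)) ≡⟨ *-suc 2 h ⟨
    2 * suc h         ≤⟨ *-monoʳ-≤ 2 h<n ⟩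
    2 * n             ∎
    where open ≤-Reasoning

-- The integer interval from 0 to h.
data Within (h : ℕ) : ℤ → Set where
  within : ∀ {a} → a ≤ h → Within h (+ a)

-- Runs of the algorithm

-- The length W/k of a block is written as p + 1: p bits are only added to y and the last one
-- closes the block.
module Run (W k p : ℕ) .{{_ : NonZero k}} (W/k≡1+p : W ℕ./ k ≡ suc p) where
  open Algorithm W k
  open State

  W/k-1≡p : W/k ℤ.- 1ℤ ≡ + p
  W/k-1≡p = cong (λ n → + n ℤ.- 1ℤ) W/k≡1+p

  -- Adding the bit x to y at the end of a block leaves y′ in y and puts c into bᵢ.
  -- The equation for y′ = y - (p + 1) + x is written without a subtraction.
  data Carry (y : ℕ) (x : Bool) : ℕ → Bool → Set where
    overflow : ∀ {y′} → suc p + y′ ≡ y + ⟦ x ⟧ → Carry y x y′ true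
    fits     : y + ⟦ x ⟧ ≤ p → Carry y x (y + ⟦ x ⟧) false

  carry-total : ∀ {y} x → y ≤ p + p → ∃[ y′ ] ∃[ c ] (y′ ≤ p × Carry y x y′ c)
  carry-total {y} x y≤ with suc p ≤? y + ⟦ x ⟧
  ... | no  ≰ = y + ⟦ x ⟧ , false , m<1+n⇒m≤n (≰⇒> ≰) , fits (m<1+n⇒m≤n (≰⇒> ≰))
  ... | yes ≤y+x = y + ⟦ x ⟧ ∸ suc p , true , y′≤p , overflow (m+[n∸m]≡n ≤y+x)
    where
    y′≤p : y + ⟦ x ⟧ ∸ suc p ≤ p
    y′≤p = begin
      y + ⟦ x ⟧ ∸ suc p ≤⟨ ∸-monoˡ-≤ (suc p) (+-mono-≤ y≤ (⟦⟧≤1 x)) ⟩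
      p + p + 1 ∸ suc p ≡⟨ cong (_∸ suc p) (+-comm (p + p) 1) ⟩
      p + p ∸ p         ≡⟨ m+n∸m≡n p p ⟩
      p                 ∎
      where open ≤-Reasoning

  carry-correct : ∀ {y x y′ c m i B b} → Carry y x y′ c →
                  carry x (state (+ y) m i B b) ≡ state (+ y′) m i B (b [ i ]≔ c)
  carry-correct {y} {x} {y′} {m = m} {i} {B} {b} cy with W/k ℤ.≤? + y ℤ.+ bit x | cy
  ... | yes _ | overflow eq = cong (λ z → state z m i B (b [ i ]≔ true)) (begin
    + y ℤ.- W/k ℤ.+ bit x         ≡⟨ cong₂ (λ n z → + y ℤ.- + n ℤ.+ z) W/k≡1+p (bit-⟦⟧ x) ⟩
    + y ℤ.- + suc p ℤ.+ + ⟦ x ⟧   ≡⟨ u-v+w y (suc p) ⟦ x ⟧ eq ⟩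
    + y′                          ∎)
    where open ≡-Reasoning
  ... | no _  | fits _ = cong (λ z → state z m i B (b [ i ]≔ false)) (+m+bit y x)
  ... | yes ≤y+x | fits y+x≤p = contradiction
    (ℤ.drop‿+≤+ (subst₂ ℤ._≤_ (cong +_ W/k≡1+p) (+m+bit y x) ≤y+x)) (<⇒≱ (s≤s y+x≤p))
  ... | no ≰y+x | overflow eq = contradiction
    (subst₂ ℤ._≤_ (cong +_ (sym W/k≡1+p)) (sym (+m+bit y x))
      (ℤ.+≤+ (subst (suc p ≤_) eq (m≤m+n (suc p) y′)))) ≰y+x

  -- One call of Add

  -- The shape of the state between two calls: y and m are natural numbers and B is the number of
  -- ones in b.
  settled : (y m : ℕ) → Fin k → Vec Bool k → State
  settled y m i b = state (+ y) (+ m) i (+ ones b) b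

  -- The bounds that hold at every moment, also between the assignments of one call.
  record InRange (s : State) : Set where
    constructor inRange
    field
      y-within : Within (p + p) (y s)
      m-within : Within p (m s)
      B-within : Within k (B s)

  -- Executing fs from s passes only through states in range, and ends in t.
  record Leads (fs : List (State → State)) (s t : State) : Set where
    constructor leads
    field
      safe    : All InRange (scanl (λ u f → f u) s fs)
      arrives : execute s fs ≡ t

  done : ∀ {s} → InRange s → Leads [] s s
  done r = leads (r ∷ []) refl

  step : ∀ {f fs s s′ t} → InRange s → f s ≡ s′ → Leads fs s′ t → Leads (f ∷ fs) s t
  step r refl (leads rs eq) = leads (r ∷ rs) eq

  y+x≤p+1+m : ∀ {y m} x → y ≤ p + m → y + ⟦ x ⟧ ≤ p + suc m
  y+x≤p+1+m {y} {m} x y≤p+m = begin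
    y + ⟦ x ⟧   ≤⟨ +-mono-≤ y≤p+m (⟦⟧≤1 x) ⟩
    p + m + 1   ≡⟨ +-comm (p + m) 1 ⟩
    suc p + m   ≡⟨ +-suc p m ⟨
    p + suc m   ∎
    where open ≤-Reasoning

  leads-inner : ∀ {y m i b} x → y ≤ p + m → m < p →
                Leads (steps x (settled y m i b)) (settled y m i b)
                      (settled (y + ⟦ x ⟧) (suc m) i b)
  leads-inner {y} {m} {i} {b} x y≤p+m m<p with + m ℤ.≟ W/k ℤ.- 1ℤ
  ... | yes m≡ = contradiction (ℤ.+-injective (trans m≡ W/k-1≡p)) (<⇒≢ m<p)
  ... | no  _  =
    step (inRange (within (≤-trans y≤p+m (+-monoʳ-≤ p (<⇒≤ m<p)))) m∈ B∈)
         (cong (λ z → state z (+ m) i (+ ones b) b) (+m+bit y x)) (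
    step (inRange y′∈ m∈ B∈)
         (cong (λ n → state (+ (y + ⟦ x ⟧)) (+ n) i (+ ones b) b) (+-comm m 1)) (
    done (inRange y′∈ (within m<p) B∈)))
    where
    m∈ = within (<⇒≤ m<p)
    B∈ = within (ones≤n b)
    y′∈ : Within (p + p) (+ (y + ⟦ x ⟧))
    y′∈ = within (≤-trans (y+x≤p+1+m x y≤p+m) (+-monoʳ-≤ p m<p))

  -- Subtracting bᵢ from B leaves the number of ones in b with bᵢ cleared.  The new bᵢ does not
  -- affect that number, so that adding it afterwards makes B the number of ones in b again.
  leads-last : ∀ {y y′ c i b} x → y ≤ p + p → Carry y x y′ c → y′ ≤ p →
               Leads (steps x (settled y p i b)) (settled y p i b)
                     (settled y′ 0 (suc (toℕ i) mod k) (b [ i ]≔ c))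
  leads-last {y} {y′} {c} {i} {b} x y≤p+p cy y′≤p with + p ℤ.≟ W/k ℤ.- 1ℤ
  ... | no  p≢ = contradiction (sym W/k-1≡p) p≢
  ... | yes _  =
    step (inRange y∈ p∈ (within (ones≤n b)))
         (cong (λ z → state (+ y) (+ p) i z b) (ones-subtract b i)) (
    step (inRange y∈ p∈ B₀∈) (carry-correct cy) (
    step (inRange y′∈ p∈ B₀∈)
         (cong (λ z → state (+ y′) (+ p) i z (b [ i ]≔ c)) (ones-add b i c)) (
    step (inRange y′∈ p∈ B₁∈) refl (
    step (inRange y′∈ 0∈ B₁∈) refl (
    done (inRange y′∈ 0∈ B₁∈))))))
    where
    y∈  = within y≤p+p
    p∈  = within ≤-refl
    0∈  = within z≤n
    y′∈ = within (≤-trans y′≤p (m≤m+n p p))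
    B₀∈ = within (ones≤n (b [ i ]≔ false))
    B₁∈ = within (ones≤n (b [ i ]≔ c))

  -- The ranges of the variables

  -- The invariant between calls.  At the start of a block it says y ≤ p, and each of the m bits
  -- read since then adds at most 1 to y.
  data Settled : State → Set where
    mk : ∀ {y m i b} → m ≤ p → y ≤ p + m → Settled (settled y m i b)

  settled-call : ∀ x {s} → Settled s → ∃[ t ] (Leads (steps x s) s t × Settled t)
  settled-call x (mk {y} {m} m≤p y≤p+m) with m ≟ p
  ... | no m≢p = _ , leads-inner x y≤p+m m<p , mk m<p (y+x≤p+1+m x y≤p+m)
    where
    m<p = ≤∧≢⇒< m≤p m≢p
  ... | yes refl with carry-total x y≤p+m
  ...   | y′ , c , y′≤p , cy =
    _ , leads-last x y≤p+m cy y′≤p , mk z≤n (≤-trans y′≤p (m≤m+n p 0))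

  settled-run : ∀ xs {s} → Settled s → Settled (foldl add s xs)
  settled-run []       st = st
  settled-run (x ∷ xs) st with settled-call x st
  ... | _ , leads _ refl , st′ = settled-run xs st′

  -- The initial bit array.
  0ᵇ : Vec Bool k
  0ᵇ = replicate k false

  initial≡ : initial ≡ settled 0 0 (0 mod k) 0ᵇ
  initial≡ = cong (λ n → state 0ℤ 0ℤ (0 mod k) (+ n) 0ᵇ) (sym (ones-replicate-false k))

  reachable-inRange : ∀ {s} → Reachable s → InRange s
  reachable-inRange (during xs x s∈)
    with settled-call x (settled-run xs (subst Settled (sym initial≡) (mk z≤n z≤n)))
  ... | _ , leads rs _ , _ = All.lookup rs s∈

  reachable-run : ∀ xs → Reachable (run xs)
  reachable-run xs = during xs false (here refl)

  -- The greatest values of the variables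

  run≡ : ∀ xs → run xs ≡ foldl add (settled 0 0 (0 mod k) 0ᵇ) xs
  run≡ xs = cong (λ s → foldl add s xs) initial≡

  run-ones : ∀ j {y m i b} → m + j ≤ p → y ≤ p + m →
             foldl add (settled y m i b) (List.replicate j true) ≡ settled (y + j) (m + j) i b
  run-ones zero {y} {m} {i} {b} _ _ =
    cong₂ (λ y m → settled y m i b) (sym (+-identityʳ y)) (sym (+-identityʳ m))
  run-ones (suc j) {y} {m} {i} {b} m+j≤p y≤p+m with leads-inner {i = i} {b} true y≤p+m m<p
    where m<p = ≤-trans (s≤s (m≤m+n m j)) (≤-trans (≤-reflexive (sym (+-suc m j))) m+j≤p)
  ... | leads _ eq = begin
    foldl add (add (settled y m i b) true) (List.replicate j true)
      ≡⟨ cong (λ s → foldl add s (List.replicate j true)) eq ⟩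
    foldl add (settled (y + 1) (suc m) i b) (List.replicate j true)
      ≡⟨ run-ones j (≤-trans (≤-reflexive (sym (+-suc m j))) m+j≤p)
           (y+x≤p+1+m true y≤p+m) ⟩
    settled (y + 1 + j) (suc m + j) i b
      ≡⟨ cong₂ (λ y m → settled y m i b) (+-assoc y 1 j) (sym (+-suc m j)) ⟩
    settled (y + suc j) (m + suc j) i b ∎
    where open ≡-Reasoning

  -- p ones, followed by the bit x that closes the block.
  block : Bool → List Bool
  block x = List.replicate p true ++ [ x ]

  run-block : ∀ x {y′ c i b} → Carry p x y′ c → y′ ≤ p →
              foldl add (settled 0 0 i b) (block x) ≡
              settled y′ 0 (suc (toℕ i) mod k) (b [ i ]≔ c)
  run-block x {y′} {c} {i} {b} cy y′≤p with leads-last {i = i} {b} x (m≤m+n p p) cy y′≤p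
  ... | leads _ eq = begin
    foldl add (settled 0 0 i b) (block x)
      ≡⟨ foldl-++ add (settled 0 0 i b) (List.replicate p true) [ x ] ⟩
    add (foldl add (settled 0 0 i b) (List.replicate p true)) x
      ≡⟨ cong (λ s → add s x) (run-ones p ≤-refl z≤n) ⟩
    add (settled p p i b) x
      ≡⟨ eq ⟩
    settled y′ 0 (suc (toℕ i) mod k) (b [ i ]≔ c) ∎
    where open ≡-Reasoning

  run-m : m (run (List.replicate p true)) ≡ + p
  run-m = trans (cong m (run≡ (List.replicate p true))) (cong m (run-ones p ≤-refl z≤n))

  run-peak : y (run (block false ++ List.replicate p true)) ≡ + (p + p)
  run-peak = cong y (begin
    run (block false ++ List.replicate p true)
      ≡⟨ run≡ (block false ++ List.replicate p true) ⟩
    foldl add (settled 0 0 (0 mod k) 0ᵇ) (block false ++ List.replicate p true)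
      ≡⟨ foldl-++ add _ (block false) (List.replicate p true) ⟩
    foldl add (foldl add (settled 0 0 (0 mod k) 0ᵇ) (block false)) (List.replicate p true)
      ≡⟨ cong (λ s → foldl add s (List.replicate p true)) (run-block false no-carry ≤-refl) ⟩
    foldl add (settled p 0 _ _) (List.replicate p true)
      ≡⟨ run-ones p ≤-refl (m≤m+n p 0) ⟩
    settled (p + p) p _ _ ∎)
    where
    open ≡-Reasoning
    no-carry : Carry p false p false
    no-carry = subst (λ n → Carry p false n false) (+-identityʳ p)
                 (fits (≤-reflexive (+-identityʳ p)))

  -- j blocks of ones.
  blocks : ℕ → List Bool
  blocks zero    = []
  blocks (suc j) = blocks j ++ block true

  -- The bit array after j blocks of ones.
  filled : ℕ → Vec Bool k
  filled zero    = 0ᵇ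
  filled (suc j) = filled j [ j mod k ]≔ true

  run-blocks : ∀ j → run (blocks j) ≡ settled 0 0 (j mod k) (filled j)
  run-blocks zero    = initial≡
  run-blocks (suc j) = begin
    run (blocks j ++ block true)
      ≡⟨ foldl-++ add initial (blocks j) (block true) ⟩
    foldl add (run (blocks j)) (block true)
      ≡⟨ cong (λ s → foldl add s (block true)) (run-blocks j) ⟩
    foldl add (settled 0 0 (j mod k) (filled j)) (block true)
      ≡⟨ run-block true (overflow (trans (+-identityʳ (suc p)) (+-comm 1 p))) z≤n ⟩
    settled 0 0 (suc (toℕ (j mod k)) mod k) (filled (suc j))
      ≡⟨ cong (λ i → settled 0 0 i (filled (suc j))) (suc-mod j k) ⟩
    settled 0 0 (suc j mod k) (filled (suc j)) ∎
    where open ≡-Reasoning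

  -- Counting blocks from 0, block j sets the bit with index j mod k, so after j blocks the bits below j are set.
  filled-true : ∀ j l → toℕ l < j → lookup (filled j) l ≡ true
  filled-true (suc j) l l<1+j with l Fin.≟ j mod k
  ... | yes refl = lookup∘update (j mod k) (filled j) true
  ... | no  l≢j  = trans (lookup∘update′ l≢j (filled j) true)
    (filled-true j l (≤∧≢⇒< (m<1+n⇒m≤n l<1+j) λ where refl → l≢j (sym (toℕ-mod l))))

  run-B : B (run (blocks k)) ≡ + k
  run-B = trans (cong B (run-blocks k))
    (cong +_ (ones-allTrue (filled k) λ l → filled-true k l (Fin.toℕ<n l)))

  run-i : + toℕ (i (run (blocks (pred k)))) ≡ + pred k
  run-i = cong +_ (begin
    toℕ (i (run (blocks (pred k)))) ≡⟨ cong (toℕ ∘ i) (run-blocks (pred k)) ⟩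
    toℕ (pred k mod k)              ≡⟨ Fin.toℕ-fromℕ< (m%n<n (pred k) k) ⟩
    pred k % k                      ≡⟨ m<n⇒m%n≡m (≤-reflexive (suc-pred k)) ⟩
    pred k                          ∎)
    where open ≡-Reasoning

  -- The total width

  -- A variable takes exactly the binary width of its greatest value, given that this value is
  -- attained after some input.
  width : ∀ (var : State → ℤ) {h w} → BinaryWidth h w →
          (∀ {s} → Reachable s → Within h (var s)) → ∀ xs → var (run xs) ≡ + h → Width var w
  width var {h} {w} bw range xs attained = record
    { enough = λ r → fitsIn (range r)
    ; least  = λ {w′} enough → binaryWidth-least bw {w′}
        (ℤ.drop‿+<+ (subst (ℤ._< + (2 ^ w′)) attained (proj₂ (enough (reachable-run xs)))))
    }
    where
    fitsIn : ∀ {v} → Within h v → FitsIn w v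
    fitsIn (within a≤h) = ℤ.+≤+ z≤n , ℤ.+<+ (≤-<-trans a≤h (BinaryWidth.fits bw))

  total-width : W ≡ suc p * k → ∃[ M ] (RequiresBits M × ∣ M -[ k +2log W ]∣≤ 6)
  total-width refl with binaryWidth (p + p) | binaryWidth p | binaryWidth (pred k) | binaryWidth k
  ... | wy , by | wm , bm | wi , bi | wB , bB =
    k + w , record
      { width-y = width y by (InRange.y-within ∘ reachable-inRange)
                    (block false ++ List.replicate p true) run-peak
      ; width-m = width m bm (InRange.m-within ∘ reachable-inRange) (List.replicate p true) run-m
      ; width-i = width (λ s → + toℕ (i s)) bi
                    (λ {s} _ → within (<⇒≤pred (Fin.toℕ<n (i s)))) (blocks (pred k)) run-i
      ; width-B = width B bB (InRange.B-within ∘ reachable-inRange) (blocks k) run-B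
      ; total   = refl
      }
    , upper , lower
    where
    open ≤-Reasoning
    n = suc p
    w = wy + wm + wi + wB

    2^w≡ : 2 ^ w ≡ 2 ^ wy * 2 ^ wm * 2 ^ wi * 2 ^ wB
    2^w≡ = trans (^-distribˡ-+-* 2 (wy + wm + wi) wB) (cong (_* 2 ^ wB)
          (trans (^-distribˡ-+-* 2 (wy + wm) wi) (cong (_* 2 ^ wi) (^-distribˡ-+-* 2 wy wm))))

    1+pred : suc (pred k) ≡ k
    1+pred = suc-pred k

    2p<2n : suc (p + p) ≤ 2 * n
    2p<2n = s≤s (+-monoʳ-≤ p (≤-trans (n≤1+n p) (m≤m+n n 0)))

    k<2k : suc k ≤ 2 * k
    k<2k = subst (λ j → suc k ≤ k + j) (sym (+-identityʳ k)) (+-monoˡ-≤ k (ℕ.>-nonZero⁻¹ k))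

    upper : 2 ^ (k + w) ≤ 2 ^ (k + 6) * W ^ 2
    upper = begin
      2 ^ (k + w)
        ≡⟨ trans (^-distribˡ-+-* 2 k w) (cong (2 ^ k *_) 2^w≡) ⟩
      2 ^ k * (2 ^ wy * 2 ^ wm * 2 ^ wi * 2 ^ wB)
        ≤⟨ *-monoʳ-≤ (2 ^ k) (*-mono-≤ (*-mono-≤ (*-mono-≤
             (binaryWidth-upper by 2p<2n)
             (binaryWidth-upper bm ≤-refl))
             (binaryWidth-upper bi (≤-reflexive 1+pred)))
             (binaryWidth-upper bB k<2k)) ⟩
      2 ^ k * (2 * (2 * n) * (2 * n) * (2 * k) * (2 * (2 * k)))
        ≡⟨ regroup (2 ^ k) n k ⟩
      2 ^ k * 2 ^ 6 * (n * k) ^ 2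
        ≡⟨ cong (_* (n * k) ^ 2) (^-distribˡ-+-* 2 k 6) ⟨
      2 ^ (k + 6) * (n * k) ^ 2 ∎
      where
      regroup : ∀ c n k → c * (2 * (2 * n) * (2 * n) * (2 * k) * (2 * (2 * k))) ≡
                          c * 64 * ((n * k) * ((n * k) * 1))
      regroup = solve-∀

    lower : 2 ^ k * W ^ 2 ≤ 2 ^ (k + w + 6)
    lower = begin
      2 ^ k * (n * k) ^ 2
        ≡⟨ cong (2 ^ k *_) (regroup n k) ⟩
      2 ^ k * (n * n * k * k)
        ≤⟨ *-monoʳ-≤ (2 ^ k) (*-mono-≤ (*-mono-≤ (*-mono-≤
             (≤-trans (s≤s (m≤m+n p p)) (BinaryWidth.fits by))
             (BinaryWidth.fits bm))
             (subst (_≤ 2 ^ wi) 1+pred (BinaryWidth.fits bi)))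
             (<⇒≤ (BinaryWidth.fits bB))) ⟩
      2 ^ k * (2 ^ wy * 2 ^ wm * 2 ^ wi * 2 ^ wB)
        ≡⟨ trans (^-distribˡ-+-* 2 k w) (cong (2 ^ k *_) 2^w≡) ⟨
      2 ^ (k + w)
        ≤⟨ ^-monoʳ-≤ 2 (m≤m+n (k + w) 6) ⟩
      2 ^ (k + w + 6) ∎
      where
      regroup : ∀ n k → (n * k) * ((n * k) * 1) ≡ n * n * k * k
      regroup = solve-∀

theorem8 : ∃[ C ] ∀ (W : ℕ) → W ≥ 1 →
    ∀ (ε : ℚ) .{{_ : Positive ε}} (k : ℕ) .{{_ : NonZero k}} →
    + k / 1 ≡ 1/2⟨ ε ⟩ → k ∣ W →
    ∃[ M ] (Algorithm.RequiresBits W k M × ∣ M -[ k +2log W ]∣≤ C)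
theorem8 = 6 , λ where
  W () ε k _ (divides zero refl)
  W _  ε k _ (divides (suc p) W≡nk) →
    Run.total-width W k p (trans (cong (ℕ._/ k) W≡nk) (m*n/n≡m (suc p) k)) W≡nk
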